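{- Let $G$ and $H$ be controllable graphs. Then $G$ and $H$ are isomorphic if and only if they are $C^2$-equivalent.
   Context: All graphs are finite and simple. For a graph $G$ on $n$ vertices with adjacency matrix $A$, let $\mathbf{1}$ be the all-ones vector in $\mathbb{R}^n$. The walk matrix of $G$ is the $n\times n$ matrix $W_G=\big[\mathbf{1}\ \ A\mathbf{1}\ \cdots\ A^{n-1}\mathbf{1}\big]$, with rows indexed by the vertices of $G$. The graph $G$ is controllable if $W_G$ is invertible. $C^2$ is the fragment of first-order logic with counting quantifiers, in the language of graphs, whose formulas use at most two distinct variables (each of which may be re-quantified). Formulas are built from atomic formulas $x=y$ and $Exy$ (adjacency), with variables ranging over vertices, using negation, disjunction (and the usual derived connectives), the quantifier $\exists$ (and the derived $\forall$), and for each non-negative integer $d$ the counting quantifier $\exists^{\ge d}$, where $\exists^{\ge d}x\,\phi$ holds in a graph if there are at least $d$ distinct vertices which can be substituted for $x$ to make $\phi$ true. A sentence is a formula without free variables. Two graphs $G$ and $H$ are $C^2$-equivalent if, for every $C^2$-sentence $\phi$, $G\models\phi$ if and only if $H\models\phi$. -}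

module Defs where

open import Data.Bool.Base using (Bool; true; false; T; if_then_else_)
open import Data.Fin.Base using (Fin; toℕ)
open import Data.Fin.Properties using (_≟_)
open import Data.Maybe.Base using (Maybe; just; nothing)
open import Data.Nat.Base using (ℕ; zero; suc)
open import Data.Product.Base using (_×_; ∃; ∃-syntax; ∃₂)
open import Data.Rational using (ℚ; 0ℚ; 1ℚ; _*_)
open import Data.Rational.Properties using (+-0-commutativeMonoid)
open import Data.Sum.Base using (_⊎_)
open import Data.Vec.Base using (Vec; lookup; replicate; _[_]≔_)
open import Data.Vec.Functional using (Vector)
open import Function.Bundles using (_⇔_; _↔_; _↣_; Inverse; Injection)
open import Relation.Binary.PropositionalEquality.Core using (_≡_; _≢_)
open import Relation.Nullary using (¬_; does)

open import Algebra.Properties.CommutativeMonoid.Sum +-0-commutativeMonoid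
  using (sum)

record Graph (n : ℕ) : Set where
  field
    adj    : Fin n → Fin n → Bool
    symm   : ∀ u v → adj u v ≡ adj v u
    irrefl : ∀ v → adj v v ≡ false

open Graph public

-- The two graphs are not assumed to have the same number of vertices.
_≅_ : ∀ {n m} → Graph n → Graph m → Set
_≅_ {n} {m} G H = ∃ λ (f : Fin n ↔ Fin m) →
  ∀ u v → adj G u v ≡ adj H (Inverse.to f u) (Inverse.to f v)

Matrix : ℕ → ℕ → Set
Matrix m n = Fin m → Fin n → ℚ

𝟏 : ∀ {n} → Vector ℚ n
𝟏 _ = 1ℚ

I : ∀ {n} → Matrix n n
I i j = if does (i ≟ j) then 1ℚ else 0ℚ

infixl 7 _·_ _·ᵥ_
infixr 8 _^_

_·_ : ∀ {l m n} → Matrix l m → Matrix m n → Matrix l n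
(M · N) i k = sum (λ j → M i j * N j k)

_·ᵥ_ : ∀ {m n} → Matrix m n → Vector ℚ n → Vector ℚ m
(M ·ᵥ x) i = sum (λ j → M i j * x j)

_^_ : ∀ {n} → Matrix n n → ℕ → Matrix n n
M ^ zero  = I
M ^ suc k = M · M ^ k

infix 4 _≐ᴹ_

_≐ᴹ_ : ∀ {m n} → Matrix m n → Matrix m n → Set
M ≐ᴹ N = ∀ i j → M i j ≡ N i j

-- The walk matrix has integer entries, so by Cramer's rule its inverse
-- over ℝ, if there is one, has rational entries: invertibility over ℚ
-- and over ℝ agree.
Invertible : ∀ {n} → Matrix n n → Set
Invertible M = ∃[ N ] (M · N ≐ᴹ I) × (N · M ≐ᴹ I)

adjacencyMatrix : ∀ {n} → Graph n → Matrix n n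
adjacencyMatrix G u v = if adj G u v then 1ℚ else 0ℚ

walkMatrix : ∀ {n} → Graph n → Matrix n n
walkMatrix G v k = (adjacencyMatrix G ^ toℕ k ·ᵥ 𝟏) v

Controllable : ∀ {n} → Graph n → Set
Controllable G = Invertible (walkMatrix G)

Var : Set
Var = Fin 2

infixr 6 _∨ᶠ_
infix  7 _≈ᶠ_

data Formula : Set where
  _≈ᶠ_ : Var → Var → Formula
  Eᶠ   : Var → Var → Formula
  ¬ᶠ_  : Formula → Formula
  _∨ᶠ_ : Formula → Formula → Formula
  ∃ᶠ   : Var → Formula → Formula
  ∃≥ᶠ  : ℕ → Var → Formula → Formula

_FreeIn_ : Var → Formula → Set
x FreeIn (y ≈ᶠ z)    = x ≡ y ⊎ x ≡ z
x FreeIn (Eᶠ y z)    = x ≡ y ⊎ x ≡ z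
x FreeIn (¬ᶠ φ)      = x FreeIn φ
x FreeIn (φ ∨ᶠ ψ)    = x FreeIn φ ⊎ x FreeIn ψ
x FreeIn (∃ᶠ y φ)    = x ≢ y × x FreeIn φ
x FreeIn (∃≥ᶠ _ y φ) = x ≢ y × x FreeIn φ

Sentence : Formula → Set
Sentence φ = ∀ x → ¬ (x FreeIn φ)

-- Assignments are partial, so that sentences can be evaluated in the
-- graph without vertices, where no total assignment exists.  An atomic
-- formula mentioning an unassigned variable is false, but this never
-- happens when evaluating a sentence.
Assignment : ℕ → Set
Assignment n = Vec (Maybe (Fin n)) 2

infix 4 _,_⊨_ _⊨_

-- Every clause is decidable, vertices ranging over Fin n, so the
-- constructive readings of ¬ and ⊎ agree with the classical ones.
_,_⊨_ : ∀ {n} → Graph n → Assignment n → Formula → Set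
G , ρ ⊨ (x ≈ᶠ y) =
  ∃₂ λ u v → lookup ρ x ≡ just u × lookup ρ y ≡ just v × u ≡ v
G , ρ ⊨ Eᶠ x y =
  ∃₂ λ u v → lookup ρ x ≡ just u × lookup ρ y ≡ just v × T (adj G u v)
G , ρ ⊨ (¬ᶠ φ)   = ¬ (G , ρ ⊨ φ)
G , ρ ⊨ (φ ∨ᶠ ψ) = (G , ρ ⊨ φ) ⊎ (G , ρ ⊨ ψ)
G , ρ ⊨ ∃ᶠ x φ   = ∃[ v ] (G , ρ [ x ]≔ just v ⊨ φ)
_,_⊨_ {n} G ρ (∃≥ᶠ d x φ) =
  ∃ λ (f : Fin d ↣ Fin n) → ∀ i → G , ρ [ x ]≔ just (Injection.to f i) ⊨ φ

_⊨_ : ∀ {n} → Graph n → Formula → Set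
G ⊨ φ = G , replicate 2 nothing ⊨ φ

C²-Equivalent : ∀ {n m} → Graph n → Graph m → Set
C²-Equivalent G H = ∀ φ → Sentence φ → (G ⊨ φ) ⇔ (H ⊨ φ)

{-# OPTIONS --safe #-}

-- In a controllable graph G every vertex is definable by a C²-formula, so
-- any graph C²-equivalent to G is a copy of it.  To define the vertices, call
-- a function on vertices definable if all its fibres are.  Anything determined
-- by finitely many definable functions is definable, and so is the number of
-- neighbours in a definable set.  If f is definable then A f is a fixed linear
-- combination of such numbers, one for each fibre of f; hence all A^k 1 are
-- definable.  The rows of the invertible walk matrix are distinct, so these
-- functions together determine the vertex.
module Submission where

open import Defs
open import Data.Bool.Base using (true; false; T; if_then_else_)
open import Data.Fin.Base using (Fin; zero; suc; toℕ; inject≤)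
open import Data.Fin.Patterns using (0F; 1F)
open import Data.Fin.Properties
  using (_≟_; any?; injective⇒≤; inject≤-injective)
open import Data.List.Base as List using (List; length; filter; allFin; tabulate)
open import Data.List.Membership.Propositional.Properties
  using (∈-lookup; ∈-filter⁺; ∈-filter⁻; ∈-allFin)
import Data.List.Membership.Setoid.Properties as Membership
open import Data.List.Relation.Unary.All as All using ()
open import Data.List.Relation.Unary.AllPairs using (_∷_)
open import Data.List.Relation.Unary.Any using (index)
open import Data.List.Relation.Unary.Unique.Propositional using (Unique)
open import Data.List.Relation.Unary.Unique.Propositional.Properties
  using (allFin⁺; filter⁺)
open import Data.Maybe.Base as Maybe using (Maybe; just; nothing)
import Data.Maybe.Properties as Maybe
open import Data.Nat.Base using (ℕ; zero; suc; _≤_)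
open import Data.Nat.Properties using (_≤?_; ≤∧≮⇒≡; ≤-reflexive; <-irrefl)
open import Data.Product.Base using (_×_; _,_; proj₁; proj₂; ∃; ∃₂; map₂)
open import Data.Rational using (ℚ; 0ℚ; 1ℚ; _+_; _*_)
open import Data.Rational.Properties as ℚ using ()
open import Data.Sum.Base as Sum using (inj₁; inj₂)
open import Data.Vec.Base using ([]; _∷_; lookup; _[_]≔_; map)
open import Data.Vec.Functional using (Vector)
open import Data.Vec.Properties using (lookup-map; map-[]≔; map-∘; map-cong; map-id)
open import Function.Base using (_∘_; id; const)
open import Function.Bundles
  using (_⇔_; _↔_; _↣_; mk⇔; mk↣; mk↔ₛ′; Equivalence; Inverse; Injection)
open import Function.Construct.Composition using (_↣-∘_)
open import Function.Construct.Symmetry using (↔-sym)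
open import Function.Properties.Inverse using (↔⇒↣)
open import Relation.Binary.Definitions using (DecidableEquality)
open import Relation.Binary.PropositionalEquality
  using (_≡_; _≗_; refl; sym; trans; cong; cong₂; subst; setoid; module ≡-Reasoning)
open import Relation.Nullary
  using (¬_; Dec; yes; no; does; T?; contradiction; toSum; recompute; ¬?; _×-dec_; _⊎-dec_)
open import Relation.Nullary.Decidable using (map′; decidable-stable; does-⇔)
open import Relation.Unary using (Decidable)
open import Algebra.Bundles using (CommutativeRing)
open import Algebra.Properties.Semiring.Sum
  (CommutativeRing.semiring ℚ.+-*-commutativeRing)
open import Algebra.Properties.Monoid.Mult ℚ.+-0-monoid
  using () renaming (_×_ to _ℚ×_)

open Equivalence using (to; from)

-- Invariance under isomorphism

≅-sym : ∀ {n m} {G : Graph n} {H : Graph m} → G ≅ H → H ≅ G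
≅-sym {G = G} {H} (f , f-adj) = ↔-sym f , λ u v →
  trans (sym (cong₂ (adj H) (Inverse.strictlyInverseˡ f u) (Inverse.strictlyInverseˡ f v)))
        (sym (f-adj (Inverse.from f u) (Inverse.from f v)))

rename : ∀ {n m} → (Fin n → Fin m) → Assignment n → Assignment m
rename f = map (Maybe.map f)

rename-inverse : ∀ {n m} (f : Fin n ↔ Fin m) ρ →
  rename (Inverse.from f) (rename (Inverse.to f) ρ) ≡ ρ
rename-inverse f ρ = begin
  rename (Inverse.from f) (rename (Inverse.to f) ρ)
    ≡⟨ map-∘ _ _ ρ ⟨
  map (Maybe.map (Inverse.from f) ∘ Maybe.map (Inverse.to f)) ρ
    ≡⟨ map-cong from-to ρ ⟩
  map id ρ
    ≡⟨ map-id ρ ⟩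
  ρ ∎
  where
  open ≡-Reasoning
  from-to : ∀ u → Maybe.map (Inverse.from f) (Maybe.map (Inverse.to f) u) ≡ u
  from-to (just u) = cong just (Inverse.strictlyInverseʳ f u)
  from-to nothing  = refl

lookup-rename : ∀ {n m} (f : Fin n → Fin m) ρ x {u} →
  lookup ρ x ≡ just u → lookup (rename f ρ) x ≡ just (f u)
lookup-rename f ρ x eq = trans (lookup-map x _ ρ) (cong (Maybe.map f) eq)

-- One implication, proved for all isomorphisms at once, suffices: under a negation the induction
-- hypothesis is applied to the inverse isomorphism, and renaming there and back restores the
-- assignment.
⊨-rename : ∀ {n m} {G : Graph n} {H : Graph m} (iso : G ≅ H) ρ φ →
  G , ρ ⊨ φ → H , rename (Inverse.to (proj₁ iso)) ρ ⊨ φ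

⊨-rename-update : ∀ {n m} {G : Graph n} {H : Graph m} (iso : G ≅ H) ρ x v φ →
  G , ρ [ x ]≔ just v ⊨ φ →
  H , rename (Inverse.to (proj₁ iso)) ρ [ x ]≔ just (Inverse.to (proj₁ iso) v) ⊨ φ
⊨-rename-update {H = H} iso ρ x v φ sat =
  subst (λ ρ → H , ρ ⊨ φ) (map-[]≔ _ ρ x) (⊨-rename iso (ρ [ x ]≔ just v) φ sat)

⊨-rename (f , _) ρ (x ≈ᶠ y) (u , v , xu , yv , u≡v) =
  _ , _ , lookup-rename _ ρ x xu , lookup-rename _ ρ y yv , cong (Inverse.to f) u≡v
⊨-rename (f , f-adj) ρ (Eᶠ x y) (u , v , xu , yv , uv) =
  _ , _ , lookup-rename _ ρ x xu , lookup-rename _ ρ y yv , subst T (f-adj u v) uv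
⊨-rename {G = G} {H} iso ρ (¬ᶠ φ) ¬sat sat = ¬sat
  (subst (λ ρ → G , ρ ⊨ φ) (rename-inverse (proj₁ iso) ρ) (⊨-rename (≅-sym {G = G} {H} iso) _ φ sat))
⊨-rename iso ρ (φ ∨ᶠ ψ) = Sum.map (⊨-rename iso ρ φ) (⊨-rename iso ρ ψ)
⊨-rename iso ρ (∃ᶠ x φ) (v , sat) = _ , ⊨-rename-update iso ρ x v φ sat
⊨-rename iso ρ (∃≥ᶠ d x φ) (g , sat) =
  ↔⇒↣ (proj₁ iso) ↣-∘ g , λ i → ⊨-rename-update iso ρ x _ φ (sat i)

≅⇒C²-Equivalent : ∀ {n m} {G : Graph n} {H : Graph m} → G ≅ H → C²-Equivalent G H
≅⇒C²-Equivalent {G = G} {H} iso φ _ =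
  mk⇔ (⊨-rename iso _ φ) (⊨-rename (≅-sym {G = G} {H} iso) _ φ)

-- Counting

lookup-injective : ∀ {A : Set} {xs : List A} → Unique xs → ∀ {i j} →
  List.lookup xs i ≡ List.lookup xs j → i ≡ j
lookup-injective (_  ∷ _) {zero}  {zero}  _  = refl
lookup-injective (x∉ ∷ _) {zero}  {suc j} eq = contradiction eq (All.lookup x∉ (∈-lookup j))
lookup-injective (x∉ ∷ _) {suc i} {zero}  eq = contradiction (sym eq) (All.lookup x∉ (∈-lookup i))
lookup-injective (_  ∷ u) {suc i} {suc j} eq = cong suc (lookup-injective u eq)

count : ∀ {n} {P : Fin n → Set} → Decidable P → ℕ
count P? = length (filter P? (allFin _))

-- The filtered list has no repetitions, so its positions correspond bijectively to the vertices
-- satisfying `P`. An injection into these vertices is thus an injection into the positions.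
↣⇔≤count : ∀ {n d} {P : Fin n → Set} (P? : Decidable P) →
  (∃ λ (f : Fin d ↣ Fin n) → ∀ i → P (Injection.to f i)) ⇔ (d ≤ count P?)
↣⇔≤count {n} {d} {P} P? = mk⇔
  (λ (f , f-P) →
    let f∈ i = ∈-filter⁺ P? (∈-allFin (Injection.to f i)) (f-P i)
    in injective⇒≤ λ {i} {j} eq → Injection.injective f
         (Membership.index-injective (setoid _) (f∈ i) (f∈ j) eq))
  (λ d≤ →
    mk↣ {to = λ i → List.lookup xs (inject≤ i d≤)}
        (λ {i} {j} eq → inject≤-injective d≤ d≤ i j
          (lookup-injective (filter⁺ P? (allFin⁺ n)) eq))
    , λ i → proj₂ (∈-filter⁻ P? {xs = allFin n} (∈-lookup {xs = xs} (inject≤ i d≤))))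
  where xs = filter P? (allFin n)

-- Stated for an arbitrary `f` because the induction passes from `f` to `f ∘ suc`.
sum-indicator-tabulate : ∀ {k} {A : Set} {P : A → Set} (P? : Decidable P) (f : Fin k → A) →
  sum (λ i → if does (P? (f i)) then 1ℚ else 0ℚ) ≡ length (filter P? (tabulate f)) ℚ× 1ℚ
sum-indicator-tabulate {zero}  P? f = refl
sum-indicator-tabulate {suc k} P? f with does (P? (f zero))
... | true  = cong (1ℚ +_) (sum-indicator-tabulate P? (f ∘ suc))
... | false = trans (ℚ.+-identityˡ _) (sum-indicator-tabulate P? (f ∘ suc))

sum-indicator : ∀ {n} {P : Fin n → Set} (P? : Decidable P) →
  sum (λ i → if does (P? i) then 1ℚ else 0ℚ) ≡ count P? ℚ× 1ℚ
sum-indicator P? = sum-indicator-tabulate P? id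

-- Two-variable formulas

⊨? : ∀ {n} (G : Graph n) ρ φ → Dec (G , ρ ⊨ φ)
⊨? G ρ (x ≈ᶠ y) = any? λ u → any? λ v →
  Maybe.≡-dec _≟_ (lookup ρ x) (just u) ×-dec
  Maybe.≡-dec _≟_ (lookup ρ y) (just v) ×-dec (u ≟ v)
⊨? G ρ (Eᶠ x y) = any? λ u → any? λ v →
  Maybe.≡-dec _≟_ (lookup ρ x) (just u) ×-dec
  Maybe.≡-dec _≟_ (lookup ρ y) (just v) ×-dec T? (adj G u v)
⊨? G ρ (¬ᶠ φ)   = ¬? (⊨? G ρ φ)
⊨? G ρ (φ ∨ᶠ ψ) = ⊨? G ρ φ ⊎-dec ⊨? G ρ ψ
⊨? G ρ (∃ᶠ x φ) = any? λ v → ⊨? G (ρ [ x ]≔ just v) φ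
⊨? G ρ (∃≥ᶠ d x φ) = map′ (from count⇔) (to count⇔) (d ≤? _)
  where count⇔ = ↣⇔≤count λ v → ⊨? G (ρ [ x ]≔ just v) φ

-- An instance of excluded middle, since `0F ≈ᶠ 0F` alone fails when variable 0 is unassigned.
⊤ᶠ ⊥ᶠ : Formula
⊤ᶠ = (0F ≈ᶠ 0F) ∨ᶠ ¬ᶠ (0F ≈ᶠ 0F)
⊥ᶠ = ¬ᶠ ⊤ᶠ

infixr 6 _∧ᶠ_
_∧ᶠ_ : Formula → Formula → Formula
φ ∧ᶠ ψ = ¬ᶠ (¬ᶠ φ ∨ᶠ ¬ᶠ ψ)

⋁ᶠ : ∀ {k} → (Fin k → Formula) → Formula
⋁ᶠ {zero}  φ = ⊥ᶠ
⋁ᶠ {suc k} φ = φ zero ∨ᶠ ⋁ᶠ (φ ∘ suc)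

⋀ᶠ : ∀ {k} → (Fin k → Formula) → Formula
⋀ᶠ φ = ¬ᶠ (⋁ᶠ λ i → ¬ᶠ (φ i))

-- The truth of `A` is decided outside the logic; in a disjunction over vertices this selects the
-- disjuncts to keep.
constᶠ : ∀ {A : Set} → Dec A → Formula
constᶠ A? = if does A? then ⊤ᶠ else ⊥ᶠ

-- φ with both variables set to the value of variable 0, respectively 1:
-- the other variable is requantified, so no substitution is needed.
at₀ at₁ : Formula → Formula
at₀ φ = ∃ᶠ 1F (0F ≈ᶠ 1F ∧ᶠ φ)
at₁ φ = ∃ᶠ 0F (0F ≈ᶠ 1F ∧ᶠ φ)

env : ∀ {n} → Fin n → Fin n → Assignment n
env v u = just v ∷ just u ∷ []

module _ {n} (G : Graph n) where

  ⊤ᶠ-holds : ∀ ρ → G , ρ ⊨ ⊤ᶠ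
  ⊤ᶠ-holds ρ = toSum (⊨? G ρ (0F ≈ᶠ 0F))

  ∧ᶠ-⇔ : ∀ ρ φ ψ → (G , ρ ⊨ φ ∧ᶠ ψ) ⇔ ((G , ρ ⊨ φ) × (G , ρ ⊨ ψ))
  ∧ᶠ-⇔ ρ φ ψ = mk⇔
    (λ h → decidable-stable (⊨? G ρ φ) (h ∘ inj₁) , decidable-stable (⊨? G ρ ψ) (h ∘ inj₂))
    (λ { (p , q) (inj₁ ¬p) → ¬p p ; (p , q) (inj₂ ¬q) → ¬q q })

  ⋁ᶠ-⇔ : ∀ {k} ρ (φ : Fin k → Formula) → (G , ρ ⊨ ⋁ᶠ φ) ⇔ (∃ λ i → G , ρ ⊨ φ i)
  ⋁ᶠ-⇔ ρ φ = mk⇔ (⋁⇒∃ φ) (λ (i , h) → ∃⇒⋁ φ i h)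
    where
    ⋁⇒∃ : ∀ {k} (φ : Fin k → Formula) → G , ρ ⊨ ⋁ᶠ φ → ∃ λ i → G , ρ ⊨ φ i
    ⋁⇒∃ {zero}  φ h        = contradiction (⊤ᶠ-holds ρ) h
    ⋁⇒∃ {suc k} φ (inj₁ h) = zero , h
    ⋁⇒∃ {suc k} φ (inj₂ h) = let i , h′ = ⋁⇒∃ (φ ∘ suc) h in suc i , h′
    ∃⇒⋁ : ∀ {k} (φ : Fin k → Formula) i → G , ρ ⊨ φ i → G , ρ ⊨ ⋁ᶠ φ
    ∃⇒⋁ φ zero    h = inj₁ h
    ∃⇒⋁ φ (suc i) h = inj₂ (∃⇒⋁ (φ ∘ suc) i h)

  ⋀ᶠ-⇔ : ∀ {k} ρ (φ : Fin k → Formula) → (G , ρ ⊨ ⋀ᶠ φ) ⇔ (∀ i → G , ρ ⊨ φ i)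
  ⋀ᶠ-⇔ ρ φ = mk⇔
    (λ h i → decidable-stable (⊨? G ρ (φ i)) λ ¬φi → h (from ⋁⇔∃ (i , ¬φi)))
    (λ h ⋁¬φ → let i , ¬φi = to ⋁⇔∃ ⋁¬φ in ¬φi (h i))
    where ⋁⇔∃ = ⋁ᶠ-⇔ ρ (λ i → ¬ᶠ (φ i))

  constᶠ-⇔ : ∀ {A} ρ (A? : Dec A) → (G , ρ ⊨ constᶠ A?) ⇔ A
  constᶠ-⇔ ρ (yes a) = mk⇔ (const a) (const (⊤ᶠ-holds ρ))
  constᶠ-⇔ ρ (no ¬a) = mk⇔ (contradiction (⊤ᶠ-holds ρ)) (λ a → contradiction a ¬a)

  ≈ᶠ-⇔ : ∀ v u → (G , env v u ⊨ 0F ≈ᶠ 1F) ⇔ (v ≡ u)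
  ≈ᶠ-⇔ v u = mk⇔ (λ { (_ , _ , refl , refl , eq) → eq }) (λ eq → v , u , refl , refl , eq)

  Eᶠ-⇔ : ∀ v u → (G , env v u ⊨ Eᶠ 0F 1F) ⇔ T (adj G v u)
  Eᶠ-⇔ v u = mk⇔ (λ { (_ , _ , refl , refl , vu) → vu }) (λ vu → v , u , refl , refl , vu)

  at₀-⇔ : ∀ v u φ → (G , env v u ⊨ at₀ φ) ⇔ (G , env v v ⊨ φ)
  at₀-⇔ v u φ = mk⇔
    (λ (w , h) → let v≈w , sat = to (∧ᶠ-⇔ (env v w) (0F ≈ᶠ 1F) φ) h
                 in subst (λ w → G , env v w ⊨ φ) (sym (to (≈ᶠ-⇔ v w) v≈w)) sat)
    (λ sat → v , from (∧ᶠ-⇔ (env v v) (0F ≈ᶠ 1F) φ) (from (≈ᶠ-⇔ v v) refl , sat))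

  at₁-⇔ : ∀ v u φ → (G , env v u ⊨ at₁ φ) ⇔ (G , env u u ⊨ φ)
  at₁-⇔ v u φ = mk⇔
    (λ (w , h) → let w≈u , sat = to (∧ᶠ-⇔ (env w u) (0F ≈ᶠ 1F) φ) h
                 in subst (λ w → G , env w u ⊨ φ) (to (≈ᶠ-⇔ w u) w≈u) sat)
    (λ sat → u , from (∧ᶠ-⇔ (env u u) (0F ≈ᶠ 1F) φ) (from (≈ᶠ-⇔ u u) refl , sat))

-- Definable functions

-- Unary formulas are evaluated with both variables set to the vertex, so
-- that no condition on free variables is needed.
Definable : ∀ {n} {X : Set} → Graph n → (Fin n → X) → Set
Definable G f = ∀ c → ∃ λ φ → ∀ v → (G , env v v ⊨ φ) ⇔ (f v ≡ c)

module _ {n} (G : Graph n) where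

  -- A vertex `u` has `h u ≡ c` exactly if it agrees under all `g i` with some `v` such that
  -- `h v ≡ c`. As the graph is finite, this is a finite disjunction over `v` of finite conjunctions
  -- over `i`.
  Definable-determined : ∀ {k} {X Y : Set} → DecidableEquality Y →
    (g : Fin k → Fin n → X) → (∀ i → Definable G (g i)) →
    (h : Fin n → Y) → (∀ u v → (∀ i → g i u ≡ g i v) → h u ≡ h v) →
    Definable G h
  Definable-determined _≟Y_ g g-def h determined c = φ , λ u → mk⇔
    (λ sat →
      let v , sat-v      = to (⋁ᶠ-⇔ G (env u u) ψ) sat
          v∈ , agree     = to (∧ᶠ-⇔ G (env u u) _ _) sat-v
      in trans (determined u v λ i →
                 to (proj₂ (g-def i (g i v)) u) (to (⋀ᶠ-⇔ G (env u u) (χ v)) agree i))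
               (to (constᶠ-⇔ G (env u u) (h v ≟Y c)) v∈))
    (λ hu≡c → from (⋁ᶠ-⇔ G (env u u) ψ)
      (u , from (∧ᶠ-⇔ G (env u u) _ _)
        ( from (constᶠ-⇔ G (env u u) (h u ≟Y c)) hu≡c
        , from (⋀ᶠ-⇔ G (env u u) (χ u)) λ i → from (proj₂ (g-def i (g i u)) u) refl)))
    where
    χ : Fin n → Fin _ → Formula
    χ v i = proj₁ (g-def i (g i v))
    ψ : Fin n → Formula
    ψ v = constᶠ (h v ≟Y c) ∧ᶠ ⋀ᶠ (χ v)
    φ = ⋁ᶠ ψ

  Definable-count : ∀ ψ → Definable G (λ v → count λ u → ⊨? G (env v u) ψ)
  Definable-count ψ c = ∃≥ᶠ c 1F ψ ∧ᶠ ¬ᶠ (∃≥ᶠ (suc c) 1F ψ) , λ v →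
    let ∧⇔ = ∧ᶠ-⇔ G (env v v) (∃≥ᶠ c 1F ψ) (¬ᶠ (∃≥ᶠ (suc c) 1F ψ))
        ψ? = λ u → ⊨? G (env v u) ψ
    in mk⇔
      (λ sat → let ≥c , ≱1+c = to ∧⇔ sat in
        sym (≤∧≮⇒≡ (to (↣⇔≤count ψ?) ≥c) (≱1+c ∘ from (↣⇔≤count ψ?))))
      (λ eq → from ∧⇔
        ( from (↣⇔≤count ψ?) (≤-reflexive (sym eq))
        , λ ≥1+c → <-irrefl (sym eq) (to (↣⇔≤count ψ?) ≥1+c)))

-- Walks

·ᵥ-assoc : ∀ {l m n} (M : Matrix l m) (N : Matrix m n) x →
  (M · N) ·ᵥ x ≗ M ·ᵥ (N ·ᵥ x)
·ᵥ-assoc M N x i = begin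
  sum (λ k → sum (λ j → M i j * N j k) * x k)
    ≡⟨ sum-cong-≗ (λ k → *-distribʳ-sum (x k) (λ j → M i j * N j k)) ⟩
  sum (λ k → sum (λ j → M i j * N j k * x k))
    ≡⟨ ∑-comm (λ k j → M i j * N j k * x k) ⟩
  sum (λ j → sum (λ k → M i j * N j k * x k))
    ≡⟨ sum-cong-≗ (λ j → sum-cong-≗ λ k → ℚ.*-assoc (M i j) (N j k) (x k)) ⟩
  sum (λ j → sum (λ k → M i j * (N j k * x k)))
    ≡⟨ sum-cong-≗ (λ j → *-distribˡ-sum (M i j) (λ k → N j k * x k)) ⟨
  sum (λ j → M i j * sum (λ k → N j k * x k)) ∎
  where open ≡-Reasoning

I-·ᵥ : ∀ {n} (x : Vector ℚ n) → I ·ᵥ x ≗ x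
I-·ᵥ {suc n} x zero = begin
  1ℚ * x zero + sum (λ j → 0ℚ * x (suc j))
    ≡⟨ cong₂ _+_ (ℚ.*-identityˡ (x zero)) (sum-cong-≗ λ j → ℚ.*-zeroˡ (x (suc j))) ⟩
  x zero + sum (λ (j : Fin n) → 0ℚ)
    ≡⟨ cong (x zero +_) (sum-replicate-zero n) ⟩
  x zero + 0ℚ
    ≡⟨ ℚ.+-identityʳ (x zero) ⟩
  x zero ∎
  where open ≡-Reasoning
I-·ᵥ {suc n} x (suc i) = begin
  0ℚ * x zero + (I ·ᵥ (x ∘ suc)) i  ≡⟨ cong₂ _+_ (ℚ.*-zeroˡ (x zero)) (I-·ᵥ (x ∘ suc) i) ⟩
  0ℚ + x (suc i)                    ≡⟨ ℚ.+-identityˡ (x (suc i)) ⟩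
  x (suc i)                         ∎
  where open ≡-Reasoning

I-diagonal⇒≡ : ∀ {n} (v u : Fin n) → I v v ≡ I u v → v ≡ u
I-diagonal⇒≡ v u eq with v ≟ v | u ≟ v
... | yes _  | yes u≡v = sym u≡v
... | no v≢v | _       = contradiction refl v≢v
I-diagonal⇒≡ v u () | yes _ | no _

module _ {n} (G : Graph n) where

  private A = adjacencyMatrix G

  -- Replacing each vertex by the representative of its fibre leaves `f` unchanged, so `A ·ᵥ f`
  -- equals `B ·ᵥ f`, which at a vertex depends only on that vertex's row of `B`. It remains to
  -- define the columns of `B`.
  Definable-adjacency : (f : Vector ℚ n) → Definable G f → Definable G (A ·ᵥ f)
  Definable-adjacency f f-def =
    Definable-determined G ℚ._≟_ (λ w v → B v w) B-def (A ·ᵥ f) λ u v eqs →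
      trans (factor u) (trans (sum-cong-≗ λ w → cong (_* f w) (eqs w)) (sym (factor v)))
    where
    -- Irrelevance of the proof of nonemptiness makes the choice depend on
    -- the value c only, giving one representative for each fibre of f.
    choose : ∀ c → .(∃ λ w → f w ≡ c) → ∃ λ w → f w ≡ c
    choose c = recompute (any? λ w → f w ℚ.≟ c)

    rep : Fin n → Fin n
    rep u = proj₁ (choose (f u) (u , refl))

    choose-cong : ∀ {c d} .p .q → c ≡ d → proj₁ (choose c p) ≡ proj₁ (choose d q)
    choose-cong _ _ refl = refl

    rep-def : Definable G rep
    rep-def = Definable-determined G {1} _≟_ (λ _ → f) (λ _ → f-def) rep
      λ u v eqs → choose-cong (u , refl) (v , refl) (eqs zero)

    -- Row `u` of `I ∘ rep` is the unit vector at `rep u`, so the entry at `v` and `w` is the number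
    -- of neighbours of `v` represented by `w`.
    B : Matrix n n
    B = A · (I ∘ rep)

    factor : A ·ᵥ f ≗ B ·ᵥ f
    factor v = begin
      (A ·ᵥ f) v
        ≡⟨ sum-cong-≗ (λ u → cong (A v u *_)
             (trans (I-·ᵥ f (rep u)) (proj₂ (choose (f u) (u , refl))))) ⟨
      (A ·ᵥ ((I ∘ rep) ·ᵥ f)) v
        ≡⟨ ·ᵥ-assoc A (I ∘ rep) f v ⟨
      (B ·ᵥ f) v ∎
      where open ≡-Reasoning

    B-def : ∀ w → Definable G (λ v → B v w)
    B-def w = Definable-determined G {1} ℚ._≟_ (λ _ → degree) (λ _ → Definable-count G ψ) _
      λ u v eqs → trans (B-degree u) (trans (cong (_ℚ× 1ℚ) (eqs zero)) (sym (B-degree v)))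
      where
      ψ = Eᶠ 0F 1F ∧ᶠ at₁ (proj₁ (rep-def w))

      degree : Fin n → ℕ
      degree v = count λ u → ⊨? G (env v u) ψ

      ψ-⇔ : ∀ v u → (G , env v u ⊨ ψ) ⇔ (T (adj G v u) × rep u ≡ w)
      ψ-⇔ v u = mk⇔
        (λ sat → let vu , u∈ = to ∧⇔ sat in
          to (Eᶠ-⇔ G v u) vu , to (proj₂ (rep-def w) u) (to (at₁-⇔ G v u _) u∈))
        (λ (vu , u∈) → from ∧⇔
          (from (Eᶠ-⇔ G v u) vu , from (at₁-⇔ G v u _) (from (proj₂ (rep-def w) u) u∈)))
        where ∧⇔ = ∧ᶠ-⇔ G (env v u) (Eᶠ 0F 1F) (at₁ (proj₁ (rep-def w)))

      entry : ∀ v u → A v u * I (rep u) w ≡ (if does (⊨? G (env v u) ψ) then 1ℚ else 0ℚ)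
      entry v u
        -- The decision of `ψ` is exchanged for one that computes as a conjunction, so that
        -- splitting on adjacency reduces both sides.
        rewrite does-⇔ (ψ-⇔ v u) (⊨? G (env v u) ψ) (T? (adj G v u) ×-dec (rep u ≟ w))
        with adj G v u
      ... | true  = ℚ.*-identityˡ (I (rep u) w)
      ... | false = ℚ.*-zeroˡ (I (rep u) w)

      B-degree : ∀ v → B v w ≡ degree v ℚ× 1ℚ
      B-degree v = trans (sum-cong-≗ (entry v)) (sum-indicator λ u → ⊨? G (env v u) ψ)

  Definable-walks : ∀ k → Definable G ((A ^ k) ·ᵥ 𝟏)
  -- A constant vector is determined by the empty family of functions.
  Definable-walks zero = Definable-determined G {0} {ℕ} ℚ._≟_ (λ ()) (λ ()) _
    λ u v _ → trans (I-·ᵥ 𝟏 u) (sym (I-·ᵥ 𝟏 v))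
  Definable-walks (suc k) c =
    map₂ (λ φ-def v → subst (λ a → _ ⇔ (a ≡ c)) (sym (·ᵥ-assoc A (A ^ k) 𝟏 v)) (φ-def v))
         (Definable-adjacency ((A ^ k) ·ᵥ 𝟏) (Definable-walks k) c)

  -- If `u` and `v` have equal rows in the walk matrix, their rows in its product with `N`, the
  -- identity, are equal too; column `u` then separates them unless they coincide.
  Controllable⇒Definable-id : Controllable G → Definable G id
  Controllable⇒Definable-id (N , WN≐I , _) =
    Definable-determined G _≟_ (λ k v → walkMatrix G v k) (λ k → Definable-walks (toℕ k)) id
      λ u v rows → I-diagonal⇒≡ u v (begin
        I u u                   ≡⟨ WN≐I u u ⟨
        (walkMatrix G · N) u u  ≡⟨ sum-cong-≗ (λ k → cong (_* N k u) (rows k)) ⟩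
        (walkMatrix G · N) v u  ≡⟨ WN≐I v u ⟩
        I v u                   ∎)
    where open ≡-Reasoning

-- Reconstruction

module _ {n m} (G : Graph n) (H : Graph m) (G≡H : C²-Equivalent G H) where

  -- Quantifying both variables turns any `ψ` into a sentence, to which the equivalence of the
  -- graphs applies.
  ∃∃-⇔ : ∀ ψ → (∃₂ λ v u → G , env v u ⊨ ψ) ⇔ (∃₂ λ v u → H , env v u ⊨ ψ)
  ∃∃-⇔ ψ = G≡H (∃ᶠ 0F (∃ᶠ 1F ψ))
    λ { 0F (0≢0 , _) → 0≢0 refl ; 1F (_ , 1≢1 , _) → 1≢1 refl }

  -- The formula defining `v` in `G` is read in `H`. Transferred sentences show that exactly one
  -- vertex of `H` satisfies it, that every vertex of `H` arises so, and that adjacency is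
  -- preserved.
  Definable-id⇒≅ : Definable G id → G ≅ H
  Definable-id⇒≅ id-def =
    mk↔ₛ′ π π⁻¹
      (λ u → unique _ (π-Is (π⁻¹ u)) (π⁻¹-Is u))
      (λ v → injective (π⁻¹-Is (π v)) (π-Is v))
    , λ v u → does-⇔ (adj⇔ v u) (T? (adj G v u)) (T? (adj H (π v) (π u)))
    where
    χ : Fin n → Formula
    χ v = proj₁ (id-def v)

    Is : Fin n → Fin m → Set
    Is v a = H , env a a ⊨ χ v

    -- In `G` the formulas `χ v` and `χ w` pin the two variables to `v` and `w`, so a sentence can
    -- speak of this particular pair. The properties of `Is` for particular vertices follow by
    -- choosing `ψ`.
    pair-⇔ : ∀ ψ v w →
      (G , env v w ⊨ ψ) ⇔ (∃₂ λ a b → (H , env a b ⊨ ψ) × Is v a × Is w b)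
    pair-⇔ ψ v w = mk⇔
      (λ sat →
        let a , b , sat′ = to (∃∃-⇔ ψ′) (v , w , from (ψ′-⇔ G v w)
              (sat , from (proj₂ (id-def v) v) refl , from (proj₂ (id-def w) w) refl))
        in a , b , to (ψ′-⇔ H a b) sat′)
      (λ (a , b , sats) →
        let v′ , w′ , sat′ = from (∃∃-⇔ ψ′) (a , b , from (ψ′-⇔ H a b) sats)
            sat , v′∈ , w′∈ = to (ψ′-⇔ G v′ w′) sat′
        in subst (λ w → G , env v w ⊨ ψ) (to (proj₂ (id-def w) w′) w′∈)
             (subst (λ v → G , env v w′ ⊨ ψ) (to (proj₂ (id-def v) v′) v′∈) sat))
      where
      ψ′ = ψ ∧ᶠ at₀ (χ v) ∧ᶠ at₁ (χ w)
      ψ′-⇔ : ∀ {k} (K : Graph k) a b → (K , env a b ⊨ ψ′) ⇔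
        ((K , env a b ⊨ ψ) × (K , env a a ⊨ χ v) × (K , env b b ⊨ χ w))
      ψ′-⇔ K a b = mk⇔
        (λ sat → let p , qr = to ∧⇔₁ sat ; q , r = to ∧⇔₂ qr
                 in p , to (at₀-⇔ K a b _) q , to (at₁-⇔ K a b _) r)
        (λ (p , q , r) → from ∧⇔₁
          (p , from ∧⇔₂ (from (at₀-⇔ K a b _) q , from (at₁-⇔ K a b _) r)))
        where
        ∧⇔₁ = ∧ᶠ-⇔ K (env a b) ψ (at₀ (χ v) ∧ᶠ at₁ (χ w))
        ∧⇔₂ = ∧ᶠ-⇔ K (env a b) (at₀ (χ v)) (at₁ (χ w))

    image : ∀ v → ∃ (Is v)
    image v =
      let a , _ , _ , v-Is-a , _ = to (pair-⇔ (0F ≈ᶠ 1F) v v) (from (≈ᶠ-⇔ G v v) refl)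
      in a , v-Is-a

    unique : ∀ v {a b} → Is v a → Is v b → a ≡ b
    unique v {a} {b} va vb = decidable-stable (a ≟ b) λ a≢b →
      -- Two distinct vertices of `H` satisfying `χ v` would make `v` differ from itself in `G`.
      from (pair-⇔ (¬ᶠ (0F ≈ᶠ 1F)) v v) (a , b , a≢b ∘ to (≈ᶠ-⇔ H a b) , va , vb)
        (from (≈ᶠ-⇔ G v v) refl)

    injective : ∀ {v w a} → Is v a → Is w a → v ≡ w
    injective {v} {w} {a} va wa = to (≈ᶠ-⇔ G v w)
      (from (pair-⇔ (0F ≈ᶠ 1F) v w) (a , a , from (≈ᶠ-⇔ H a a) refl , va , wa))

    preimage : ∀ a → ∃ λ v → Is v a
    preimage a = decidable-stable (any? λ v → ⊨? H (env a a) (χ v)) λ none →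
      -- A vertex of `H` satisfying no `χ w` would yield one in `G`, where each vertex satisfies its
      -- own formula. The second quantified variable is a dummy.
      let v , u , sat = from (∃∃-⇔ (¬ᶠ (⋁ᶠ (at₀ ∘ χ)))) (a , a , λ some →
            let w , sat = to (⋁ᶠ-⇔ H (env a a) (at₀ ∘ χ)) some
            in none (w , to (at₀-⇔ H a a (χ w)) sat))
      in sat (from (⋁ᶠ-⇔ G (env v u) (at₀ ∘ χ))
           (v , from (at₀-⇔ G v u (χ v)) (from (proj₂ (id-def v) v) refl)))

    π : Fin n → Fin m
    π v = proj₁ (image v)

    π-Is : ∀ v → Is v (π v)
    π-Is v = proj₂ (image v)

    π⁻¹ : Fin m → Fin n
    π⁻¹ a = proj₁ (preimage a)

    π⁻¹-Is : ∀ a → Is (π⁻¹ a) a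
    π⁻¹-Is a = proj₂ (preimage a)

    adj⇔ : ∀ v u → T (adj G v u) ⇔ T (adj H (π v) (π u))
    adj⇔ v u = mk⇔
      (λ vu →
        let a , b , ab , va , ub = to (pair-⇔ (Eᶠ 0F 1F) v u) (from (Eᶠ-⇔ G v u) vu)
        in subst T (cong₂ (adj H) (unique v va (π-Is v)) (unique u ub (π-Is u)))
             (to (Eᶠ-⇔ H a b) ab))
      (λ πvu → to (Eᶠ-⇔ G v u) (from (pair-⇔ (Eᶠ 0F 1F) v u)
        (π v , π u , from (Eᶠ-⇔ H (π v) (π u)) πvu , π-Is v , π-Is u)))

theorem6 : ∀ (n m : ℕ) (G : Graph n) (H : Graph m) →
    Controllable G → Controllable H → (G ≅ H) ⇔ C²-Equivalent G H
theorem6 n m G H G-ctrl _ = mk⇔ ≅⇒C²-Equivalent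
  λ G≡H → Definable-id⇒≅ G H G≡H (Controllable⇒Definable-id G G-ctrl)
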